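{- Let $\mathsf{L}\in\{\mathsf{CN4K},\mathsf{CN4K}^\pm,\mathsf{CN4K}^\curlyvee,\mathsf{CN4K}^{\Join},\mathsf{CN4K}^1\}$ and $\phi,\chi\in\mathcal{L}$. Then (disjunction property) $\mathsf{L}\models\phi\vee\chi$ iff $\mathsf{L}\models\phi$ or $\mathsf{L}\models\chi$; and (constructive falsity) $\mathsf{L}\models{\sim}(\phi\wedge\chi)$ iff $\mathsf{L}\models{\sim}\phi$ or $\mathsf{L}\models{\sim}\chi$.
   Context: Fix a countable set $\mathsf{Prop}$ of propositional variables. The language $\mathcal{L}$ is given by the grammar $\phi::=p\mid{\sim}\phi\mid(\phi\wedge\phi)\mid(\phi\vee\phi)\mid(\phi\to\phi)\mid\Box\phi\mid\Diamond\phi$ with $p\in\mathsf{Prop}$. A $\mathsf{CN4K}$ frame is a tuple $\mathfrak{F}=\langle W,\le,R^+_\Box,R^-_\Box,R^+_\Diamond,R^-_\Diamond\rangle$ where $W\neq\varnothing$, $\le$ is a preorder on $W$, and $R^+_\Box,R^-_\Box,R^+_\Diamond,R^-_\Diamond$ are arbitrary binary relations on $W$. $R(w)=\{w'\mid wRw'\}$. The frame is $\pm$-birelational if $R^+_\Box=R^+_\Diamond$ and $R^-_\Box=R^-_\Diamond$; $\curlyvee$-birelational if $R^+_\Box=R^-_\Box$ and $R^+_\Diamond=R^-_\Diamond$; $\Join$-birelational if $R^+_\Box=R^-_\Diamond$ and $R^+_\Diamond=R^-_\Box$; monorelational if all four relations coincide. A $\mathsf{CN4K}$ model is $\mathfrak{M}=\langle\mathfrak{F},v^+,v^-\rangle$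 with $v^+,v^-:\mathsf{Prop}\to2^W$ upward closed under $\le$. Support: $w\Vdash^\pm p$ iff $w\in v^\pm(p)$; $w\Vdash^+{\sim}\phi$ iff $w\Vdash^-\phi$; $w\Vdash^-{\sim}\phi$ iff $w\Vdash^+\phi$; $w\Vdash^+\phi\wedge\chi$ iff both; $w\Vdash^-\phi\wedge\chi$ iff $w\Vdash^-\phi$ or $w\Vdash^-\chi$; $w\Vdash^+\phi\vee\chi$ iff $w\Vdash^+\phi$ or $w\Vdash^+\chi$; $w\Vdash^-\phi\vee\chi$ iff both negatively supported; $w\Vdash^+\phi\to\chi$ iff for all $w'\ge w$, $w'\Vdash^+\phi$ implies $w'\Vdash^+\chi$; $w\Vdash^-\phi\to\chi$ iff $w\Vdash^+\phi$ and $w\Vdash^-\chi$; $w\Vdash^+\Box\phi$ iff $\forall w'\ge w\ \forall w''\in R^+_\Box(w')$: $w''\Vdash^+\phi$; $w\Vdash^-\Box\phi$ iff $\forall w'\ge w\ \exists w''\in R^-_\Box(w')$: $w''\Vdash^-\phi$; $w\Vdash^+\Diamond\phi$ iff $\forall w'\ge w\ \exists w''\in R^+_\Diamond(w')$: $w''\Vdash^+\phi$; $w\Vdash^-\Diamond\phi$ iff $\forall w'\ge w\ \forall w''\in R^-_\Diamond(w')$: $w''\Vdash^-\phi$. $\mathsf{CN4K}$, $\mathsf{CN4K}^\pm$, $\mathsf{CN4K}^\curlyvee$, $\mathsf{CN4K}^{\Join}$, $\mathsf{CN4K}^1$ are the logics of, respectively, all frames, $\pm$-birelational, $\curlyvee$-birelational,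 $\Join$-birelational, and monorelational frames; $\mathsf{L}\models\chi$ means $\mathfrak{M},w\Vdash^+\chi$ for every model $\mathfrak{M}$ on a frame of the class of $\mathsf{L}$ and every state $w$ of $\mathfrak{M}$. -}

module Defs where

open import Data.Product using (_×_; ∃-syntax)
open import Data.Sum using (_⊎_)
open import Data.Unit.Polymorphic using (⊤)
open import Level using (Level; suc)
open import Relation.Binary.Core using (Rel; _⇔_)
open import Relation.Binary.Definitions using (_Respects_)
open import Relation.Binary.PropositionalEquality using (_≡_)
open import Relation.Binary.Structures using (IsPreorder)
open import Relation.Unary using (Pred)

infix  30 ∼_ □_ ◇_
infixr 25 _∧_
infixr 24 _∨_
infixr 23 _⊃_

data Formula (Var : Set) : Set where
  var : Var → Formula Var
  ∼_  : Formula Var → Formula Var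
  _∧_ : Formula Var → Formula Var → Formula Var
  _∨_ : Formula Var → Formula Var → Formula Var
  _⊃_ : Formula Var → Formula Var → Formula Var
  □_  : Formula Var → Formula Var
  ◇_  : Formula Var → Formula Var

record Frame (ℓ : Level) : Set (suc ℓ) where
  infix 4 _≤_
  field
    W          : Set ℓ
    nonempty   : W
    _≤_        : Rel W ℓ
    isPreorder : IsPreorder _≡_ _≤_
    R□⁺        : Rel W ℓ
    R□⁻        : Rel W ℓ
    R◇⁺        : Rel W ℓ
    R◇⁻        : Rel W ℓ

-- Equality of accessibility relations is extensional: _⇔_ is mutual inclusion.
module _ {ℓ} (F : Frame ℓ) where
  open Frame F

  ±-Birelational : Set ℓ
  ±-Birelational = (R□⁺ ⇔ R◇⁺) × (R□⁻ ⇔ R◇⁻)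

  ⋎-Birelational : Set ℓ
  ⋎-Birelational = (R□⁺ ⇔ R□⁻) × (R◇⁺ ⇔ R◇⁻)

  ⋈-Birelational : Set ℓ
  ⋈-Birelational = (R□⁺ ⇔ R◇⁻) × (R◇⁺ ⇔ R□⁻)

  Monorelational : Set ℓ
  Monorelational = (R□⁺ ⇔ R□⁻) × (R□⁻ ⇔ R◇⁺) × (R◇⁺ ⇔ R◇⁻)

record Model (Var : Set) {ℓ} (F : Frame ℓ) : Set (suc ℓ) where
  open Frame F
  field
    v⁺        : Var → Pred W ℓ
    v⁻        : Var → Pred W ℓ
    v⁺-upward : ∀ p → v⁺ p Respects _≤_
    v⁻-upward : ∀ p → v⁻ p Respects _≤_

module Support {Var : Set} {ℓ} {F : Frame ℓ} (M : Model Var F) where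
  open Frame F
  open Model M

  infix 4 _⊩⁺_ _⊩⁻_

  _⊩⁺_ : W → Formula Var → Set ℓ
  _⊩⁻_ : W → Formula Var → Set ℓ

  w ⊩⁺ var p = v⁺ p w
  w ⊩⁺ ∼ φ   = w ⊩⁻ φ
  w ⊩⁺ φ ∧ χ = w ⊩⁺ φ × w ⊩⁺ χ
  w ⊩⁺ φ ∨ χ = w ⊩⁺ φ ⊎ w ⊩⁺ χ
  w ⊩⁺ φ ⊃ χ = ∀ w′ → w ≤ w′ → w′ ⊩⁺ φ → w′ ⊩⁺ χ
  w ⊩⁺ □ φ   = ∀ w′ → w ≤ w′ → ∀ w″ → R□⁺ w′ w″ → w″ ⊩⁺ φ
  w ⊩⁺ ◇ φ   = ∀ w′ → w ≤ w′ → ∃[ w″ ] (R◇⁺ w′ w″ × w″ ⊩⁺ φ)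

  w ⊩⁻ var p = v⁻ p w
  w ⊩⁻ ∼ φ   = w ⊩⁺ φ
  w ⊩⁻ φ ∧ χ = w ⊩⁻ φ ⊎ w ⊩⁻ χ
  w ⊩⁻ φ ∨ χ = w ⊩⁻ φ × w ⊩⁻ χ
  w ⊩⁻ φ ⊃ χ = w ⊩⁺ φ × w ⊩⁻ χ
  w ⊩⁻ □ φ   = ∀ w′ → w ≤ w′ → ∃[ w″ ] (R□⁻ w′ w″ × w″ ⊩⁻ φ)
  w ⊩⁻ ◇ φ   = ∀ w′ → w ≤ w′ → ∀ w″ → R◇⁻ w′ w″ → w″ ⊩⁻ φ

data Logic : Set where
  CN4K CN4K± CN4K⋎ CN4K⋈ CN4K¹ : Logic

FrameOf : ∀ {ℓ} → Logic → Frame ℓ → Set ℓ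
FrameOf CN4K  F = ⊤
FrameOf CN4K± F = ±-Birelational F
FrameOf CN4K⋎ F = ⋎-Birelational F
FrameOf CN4K⋈ F = ⋈-Birelational F
FrameOf CN4K¹ F = Monorelational F

-- A Set-sized universe must be fixed to quantify over all frames, so validity
-- is indexed by the level ℓ of the frames.
infix 4 _⊨[_]_

_⊨[_]_ : {Var : Set} → Logic → (ℓ : Level) → Formula Var → Set (suc ℓ)
_⊨[_]_ {Var} L ℓ φ =
  (F : Frame ℓ) → FrameOf L F → (M : Model Var F) →
  let open Support M in ∀ w → w ⊩⁺ φ

{-# OPTIONS --safe #-}

-- Formulas are put in negation normal form, where L-validity becomes validity
-- over all Kripke structures with four unrelated accessibility relations.  The
-- partitions (S⁺ , S⁻) of the set Σ of subformulas of A ⊔ B are the candidate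
-- worlds of a finite model.  Partitions lacking a witness for one of their
-- formulas are discarded one after the other; for a discarded S, the sequent
-- S⁺ ⇒ S⁻ is semantically valid, and by cuts over Σ every sequent compatible
-- with no surviving partition is valid too.  Hence either one of A and B is
-- valid, or two surviving partitions refute A and B.  In the latter case a root
-- below the whole model, without successors, refutes A ⊔ B.

module Submission where

open import Defs
open import Data.Empty using (⊥; ⊥-elim)
open import Data.Fin.Base using (Fin)
open import Data.Fin.Patterns using (0F; 1F; 2F; 3F)
import Data.Fin.Properties as Fin
open import Data.List.Base using (List; []; _∷_; _++_; [_]; map; length)
open import Data.List.Membership.Propositional using (_∈_; lose)
open import Data.List.Membership.Propositional.Properties
  using (∈-++⁺ˡ; ∈-++⁺ʳ; ∈-++⁻; ∈-map⁺; ∈-map⁻; ∈-∃++)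
open import Data.List.Properties using (length-++-sucʳ)
open import Data.List.Relation.Unary.All as All using (All; []; _∷_)
open import Data.List.Relation.Unary.Any using (Any; here; there)
open import Data.Maybe.Base using (Maybe; just; nothing)
open import Data.Nat.Base as ℕ using (ℕ; zero; suc)
import Data.Nat.Properties as ℕ
open import Data.Product using (_×_; _,_; proj₁; proj₂; ∃-syntax; map₁; map₂)
open import Data.Sign.Base using (Sign; opposite)
import Data.Sign.Properties as Sign
open import Data.Sum as Sum using (_⊎_; inj₁; inj₂; [_,_]′)
open import Function.Base using (_∘_; id)
open import Function.Bundles using (_⇔_; _↣_; mk⇔)
open import Level using (Level; Lift; lift; lower; 0ℓ)
open import Relation.Binary.Core using (Rel) renaming (_⇔_ to _⇔ᵣ_)
open import Relation.Binary.Definitions using (DecidableEquality; _Respects_)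
open import Relation.Binary.PropositionalEquality using (_≡_; refl; isEquivalence; subst)
open import Relation.Binary.Structures using (IsPreorder)
open import Relation.Nullary.Decidable
  using (yes; no; map′; _×-dec_; _⊎-dec_; via-injection)
open import Relation.Nullary.Negation using (¬_; contradiction)
open import Relation.Unary using (Pred; Decidable)

-- Finite choices over lists

-- `R` may be a semantic statement with no decision procedure; each element either yields it or
-- satisfies `P`, so a finite search settles the alternative constructively.
∀-⊎-distrib : ∀ {a p r} {A : Set a} {P : Pred A p} {R : Set r} (xs : List A) →
              (∀ {x} → x ∈ xs → R ⊎ P x) → R ⊎ (∀ {x} → x ∈ xs → P x)
∀-⊎-distrib []       f = inj₂ λ ()
∀-⊎-distrib (x ∷ xs) f with f (here refl) | ∀-⊎-distrib xs (f ∘ there)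
... | inj₁ r | _      = inj₁ r
... | inj₂ _ | inj₁ r = inj₁ r
... | inj₂ p | inj₂ g = inj₂ λ where
  (here refl) → p
  (there m)   → g m

module _ {A : Set} where

  -- Positions are split rather than elements: an element listed twice may fall on both sides. For
  -- literals, `Pos` and `Neg` exclude this later.
  partitions : List A → List (List A × List A)
  partitions []       = [ [] , [] ]
  partitions (x ∷ xs) =
    map (map₁ (x ∷_)) (partitions xs) ++ map (map₂ (x ∷_)) (partitions xs)

  partitions-complete : ∀ {x} xs {S} → S ∈ partitions xs → x ∈ xs →
                        x ∈ proj₁ S ⊎ x ∈ proj₂ S
  partitions-complete (y ∷ ys) S∈ x∈ with ∈-++⁻ (map (map₁ (y ∷_)) (partitions ys)) S∈
  partitions-complete (y ∷ ys) S∈ x∈ | inj₁ m with ∈-map⁻ _ m | x∈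
  ... | T , T∈ , refl | here refl = inj₁ (here refl)
  ... | T , T∈ , refl | there x∈′ = Sum.map₁ there (partitions-complete ys T∈ x∈′)
  partitions-complete (y ∷ ys) S∈ x∈ | inj₂ m with ∈-map⁻ _ m | x∈
  ... | T , T∈ , refl | here refl = inj₂ (here refl)
  ... | T , T∈ , refl | there x∈′ = Sum.map₂ there (partitions-complete ys T∈ x∈′)

  partitions-sound : ∀ {x} xs {S} → S ∈ partitions xs →
                     x ∈ proj₁ S ⊎ x ∈ proj₂ S → x ∈ xs
  partitions-sound [] (here refl) (inj₁ ())
  partitions-sound [] (here refl) (inj₂ ())
  partitions-sound (y ∷ ys) S∈ x∈ with ∈-++⁻ (map (map₁ (y ∷_)) (partitions ys)) S∈
  partitions-sound (y ∷ ys) S∈ x∈ | inj₁ m with ∈-map⁻ _ m | x∈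
  ... | T , T∈ , refl | inj₁ (here refl) = here refl
  ... | T , T∈ , refl | inj₁ (there x∈′) = there (partitions-sound ys T∈ (inj₁ x∈′))
  ... | T , T∈ , refl | inj₂ x∈′         = there (partitions-sound ys T∈ (inj₂ x∈′))
  partitions-sound (y ∷ ys) S∈ x∈ | inj₂ m with ∈-map⁻ _ m | x∈
  ... | T , T∈ , refl | inj₂ (here refl) = here refl
  ... | T , T∈ , refl | inj₂ (there x∈′) = there (partitions-sound ys T∈ (inj₂ x∈′))
  ... | T , T∈ , refl | inj₁ x∈′         = there (partitions-sound ys T∈ (inj₁ x∈′))

  -- Iterated cut: the excluded middle for H is never used.
  cut : ∀ {h x} {H : Pred A h} {X : Set x} xs →
        (∀ {P N} → (P , N) ∈ partitions xs → All H P → Any H N ⊎ X) → X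
  cut [] f = [ (λ ()) , id ]′ (f (here refl) [])
  cut {H = H} {X} (x ∷ xs) f = cut xs split
    where
    split : ∀ {P N} → (P , N) ∈ partitions xs → All H P → Any H N ⊎ X
    -- `x` is first put on the right. If `H x` itself comes out, it becomes a hypothesis for a
    -- second call with `x` on the left.
    split m hs with f (∈-++⁺ʳ _ (∈-map⁺ _ m)) hs
    ... | inj₁ (here h)  = f (∈-++⁺ˡ (∈-map⁺ _ m)) (h ∷ hs)
    ... | inj₁ (there n) = inj₁ n
    ... | inj₂ x         = inj₂ x

-- Negation normal forms

pattern □⁺ = 0F
pattern □⁻ = 1F
pattern ◇⁺ = 2F
pattern ◇⁻ = 3F

infixr 25 _⊓_
infixr 24 _⊔_
infixr 23 _⇒_

data NNF (Var : Set) : Set where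
  lit         : Sign → Var → NNF Var
  _⊓_ _⊔_ _⇒_ : NNF Var → NNF Var → NNF Var
  ■ ⬥         : Fin 4 → NNF Var → NNF Var

-- Kripke structures and forcing

record Kripke (Var : Set) (ℓ : Level) : Set (Level.suc ℓ) where
  infix 4 _≤_
  field
    W          : Set ℓ
    _≤_        : Rel W ℓ
    isPreorder : IsPreorder _≡_ _≤_
    R          : Fin 4 → Rel W ℓ
    v⁺ v⁻      : Var → Pred W ℓ
    v⁺-upward  : ∀ p → v⁺ p Respects _≤_
    v⁻-upward  : ∀ p → v⁻ p Respects _≤_

  ≤-refl : ∀ {w} → w ≤ w
  ≤-refl = IsPreorder.refl isPreorder

  ≤-trans : ∀ {u v w} → u ≤ v → v ≤ w → u ≤ w
  ≤-trans = IsPreorder.trans isPreorder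

module Forcing {Var : Set} {ℓ : Level} (K : Kripke Var ℓ) where
  open Kripke K

  infix 4 _⊩_

  _⊩_ : W → NNF Var → Set ℓ
  w ⊩ lit Sign.+ p = v⁺ p w
  w ⊩ lit Sign.- p = v⁻ p w
  w ⊩ A ⊓ B        = w ⊩ A × w ⊩ B
  w ⊩ A ⊔ B        = w ⊩ A ⊎ w ⊩ B
  w ⊩ A ⇒ B        = ∀ w′ → w ≤ w′ → w′ ⊩ A → w′ ⊩ B
  w ⊩ ■ i A        = ∀ w′ → w ≤ w′ → ∀ w″ → R i w′ w″ → w″ ⊩ A
  w ⊩ ⬥ i A        = ∀ w′ → w ≤ w′ → ∃[ w″ ] (R i w′ w″ × w″ ⊩ A)

  -- The clauses for `⇒`, `■` and `⬥` already range over all worlds above, so transitivity of `≤`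
  -- settles them.
  ⊩-upward : ∀ A {w w′} → w ≤ w′ → w ⊩ A → w′ ⊩ A
  ⊩-upward (lit Sign.+ p) le h       = v⁺-upward p le h
  ⊩-upward (lit Sign.- p) le h       = v⁻-upward p le h
  ⊩-upward (A ⊓ B)        le (h , k) = ⊩-upward A le h , ⊩-upward B le k
  ⊩-upward (A ⊔ B)        le h       = Sum.map (⊩-upward A le) (⊩-upward B le) h
  ⊩-upward (A ⇒ B)        le h u le′ = h u (≤-trans le le′)
  ⊩-upward (■ i A)        le h u le′ = h u (≤-trans le le′)
  ⊩-upward (⬥ i A)        le h u le′ = h u (≤-trans le le′)

Valid : ∀ {Var} (ℓ : Level) → NNF Var → Set (Level.suc ℓ)
Valid {Var} ℓ A = (K : Kripke Var ℓ) → let open Forcing K in ∀ w → w ⊩ A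

-- Subformulas

module _ {Var : Set} where

  subformulas : NNF Var → List (NNF Var)
  subformulas (lit s p) = lit s p ∷ []
  subformulas (A ⊓ B)   = A ⊓ B ∷ subformulas A ++ subformulas B
  subformulas (A ⊔ B)   = A ⊔ B ∷ subformulas A ++ subformulas B
  subformulas (A ⇒ B)   = A ⇒ B ∷ subformulas A ++ subformulas B
  subformulas (■ i A)   = ■ i A ∷ subformulas A
  subformulas (⬥ i A)   = ⬥ i A ∷ subformulas A

  ∈-subformulas-refl : ∀ A → A ∈ subformulas A
  ∈-subformulas-refl (lit _ _) = here refl
  ∈-subformulas-refl (_ ⊓ _)   = here refl
  ∈-subformulas-refl (_ ⊔ _)   = here refl
  ∈-subformulas-refl (_ ⇒ _)   = here refl
  ∈-subformulas-refl (■ _ _)   = here refl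
  ∈-subformulas-refl (⬥ _ _)   = here refl

  ∈-subformulas-trans : ∀ {A B} C → A ∈ subformulas B → B ∈ subformulas C →
                        A ∈ subformulas C
  ∈-subformulas-trans₂ : ∀ {A B} C D → A ∈ subformulas B →
                         B ∈ subformulas C ++ subformulas D →
                         A ∈ subformulas C ++ subformulas D

  ∈-subformulas-trans (lit _ _) a (here refl) = a
  ∈-subformulas-trans (_ ⊓ _)   a (here refl) = a
  ∈-subformulas-trans (C ⊓ D)   a (there b)   = there (∈-subformulas-trans₂ C D a b)
  ∈-subformulas-trans (_ ⊔ _)   a (here refl) = a
  ∈-subformulas-trans (C ⊔ D)   a (there b)   = there (∈-subformulas-trans₂ C D a b)
  ∈-subformulas-trans (_ ⇒ _)   a (here refl) = a
  ∈-subformulas-trans (C ⇒ D)   a (there b)   = there (∈-subformulas-trans₂ C D a b)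
  ∈-subformulas-trans (■ _ _)   a (here refl) = a
  ∈-subformulas-trans (■ _ C)   a (there b)   = there (∈-subformulas-trans C a b)
  ∈-subformulas-trans (⬥ _ _)   a (here refl) = a
  ∈-subformulas-trans (⬥ _ C)   a (there b)   = there (∈-subformulas-trans C a b)

  ∈-subformulas-trans₂ C D a b with ∈-++⁻ (subformulas C) b
  ... | inj₁ m = ∈-++⁺ˡ (∈-subformulas-trans C a m)
  ... | inj₂ m = ∈-++⁺ʳ _ (∈-subformulas-trans D a m)

  left : ∀ A B → A ∈ subformulas A ++ subformulas B
  left A B = ∈-++⁺ˡ (∈-subformulas-refl A)

  right : ∀ A B → B ∈ subformulas A ++ subformulas B
  right A B = ∈-++⁺ʳ (subformulas A) (∈-subformulas-refl B)

-- Decidable equality of normal forms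

module _ {Var : Set} (_≟ᵥ_ : DecidableEquality Var) where

  infix 4 _≟_

  _≟_ : DecidableEquality (NNF Var)
  lit s p ≟ lit t q =
    map′ (λ { (refl , refl) → refl }) (λ { refl → refl , refl }) (s Sign.≟ t ×-dec p ≟ᵥ q)
  A ⊓ B ≟ C ⊓ D =
    map′ (λ { (refl , refl) → refl }) (λ { refl → refl , refl }) (A ≟ C ×-dec B ≟ D)
  A ⊔ B ≟ C ⊔ D =
    map′ (λ { (refl , refl) → refl }) (λ { refl → refl , refl }) (A ≟ C ×-dec B ≟ D)
  A ⇒ B ≟ C ⇒ D =
    map′ (λ { (refl , refl) → refl }) (λ { refl → refl , refl }) (A ≟ C ×-dec B ≟ D)
  ■ i A ≟ ■ j B =
    map′ (λ { (refl , refl) → refl }) (λ { refl → refl , refl }) (i Fin.≟ j ×-dec A ≟ B)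
  ⬥ i A ≟ ⬥ j B =
    map′ (λ { (refl , refl) → refl }) (λ { refl → refl , refl }) (i Fin.≟ j ×-dec A ≟ B)
  lit _ _ ≟ _ ⊓ _   = no λ ()
  lit _ _ ≟ _ ⊔ _   = no λ ()
  lit _ _ ≟ _ ⇒ _   = no λ ()
  lit _ _ ≟ ■ _ _   = no λ ()
  lit _ _ ≟ ⬥ _ _   = no λ ()
  _ ⊓ _   ≟ lit _ _ = no λ ()
  _ ⊓ _   ≟ _ ⊔ _   = no λ ()
  _ ⊓ _   ≟ _ ⇒ _   = no λ ()
  _ ⊓ _   ≟ ■ _ _   = no λ ()
  _ ⊓ _   ≟ ⬥ _ _   = no λ ()
  _ ⊔ _   ≟ lit _ _ = no λ ()
  _ ⊔ _   ≟ _ ⊓ _   = no λ ()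
  _ ⊔ _   ≟ _ ⇒ _   = no λ ()
  _ ⊔ _   ≟ ■ _ _   = no λ ()
  _ ⊔ _   ≟ ⬥ _ _   = no λ ()
  _ ⇒ _   ≟ lit _ _ = no λ ()
  _ ⇒ _   ≟ _ ⊓ _   = no λ ()
  _ ⇒ _   ≟ _ ⊔ _   = no λ ()
  _ ⇒ _   ≟ ■ _ _   = no λ ()
  _ ⇒ _   ≟ ⬥ _ _   = no λ ()
  ■ _ _   ≟ lit _ _ = no λ ()
  ■ _ _   ≟ _ ⊓ _   = no λ ()
  ■ _ _   ≟ _ ⊔ _   = no λ ()
  ■ _ _   ≟ _ ⇒ _   = no λ ()
  ■ _ _   ≟ ⬥ _ _   = no λ ()
  ⬥ _ _   ≟ lit _ _ = no λ ()
  ⬥ _ _   ≟ _ ⊓ _   = no λ ()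
  ⬥ _ _   ≟ _ ⊔ _   = no λ ()
  ⬥ _ _   ≟ _ ⇒ _   = no λ ()
  ⬥ _ _   ≟ ■ _ _   = no λ ()

-- Elimination of partitions

module Elimination {Var : Set} (_≟ᵥ_ : DecidableEquality Var) (ℓ : Level) (C : NNF Var) where

  open import Data.List.Membership.DecPropositional (_≟_ _≟ᵥ_) using (_∈?_)

  infix 4 _≟ₙ_

  _≟ₙ_ : DecidableEquality (NNF Var)
  _≟ₙ_ = _≟_ _≟ᵥ_

  Σ : List (NNF Var)
  Σ = subformulas C

  Part : Set
  Part = List (NNF Var) × List (NNF Var)

  infix 8 _⁺ _⁻

  _⁺ _⁻ : Part → List (NNF Var)
  _⁺ = proj₁
  _⁻ = proj₂

  sub : ∀ {A B} → B ∈ Σ → A ∈ subformulas B → A ∈ Σ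
  sub B∈Σ A∈B = ∈-subformulas-trans C A∈B B∈Σ

  -- Validity of a sequent with several conclusions, read constructively: at each world a true
  -- member of `Δ` is exhibited.
  Entails : Pred (NNF Var) 0ℓ → Pred (NNF Var) 0ℓ → Set (Level.suc ℓ)
  Entails Γ Δ = (K : Kripke Var ℓ) → let open Forcing K in
    ∀ w → (∀ {A} → Γ A → w ⊩ A) → ∃[ A ] (Δ A × w ⊩ A)

  Refuted : Part → Set (Level.suc ℓ)
  Refuted S = Entails (_∈ S ⁺) (_∈ S ⁻)

  -- Relativised to `Σ` so that a finite search can establish it.
  Extends : Pred (NNF Var) 0ℓ → Pred (NNF Var) 0ℓ → Part → Set
  Extends Γ Δ T = ∀ {A} → A ∈ Σ → (Γ A → A ∈ T ⁺) × (Δ A → A ∈ T ⁻)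

  Realised : List Part → Pred (NNF Var) 0ℓ → Pred (NNF Var) 0ℓ → Set
  Realised G Γ Δ = ∃[ T ] (T ∈ G × Extends Γ Δ T)

  Clash : Pred (NNF Var) 0ℓ → Pred (NNF Var) 0ℓ → Part → Set
  Clash Γ Δ T = ∃[ A ] (Γ A × A ∈ T ⁻ ⊎ Δ A × A ∈ T ⁺)

  -- c is the formula that a world promises to refute at its successors, in case
  -- it is of the form ⬥ i A and belongs to S ⁻.
  Banned : Part → NNF Var → Fin 4 → Pred (NNF Var) 0ℓ
  Banned S c i A = ⬥ i A ≡ c × c ∈ S ⁻

  -- What makes the members of `S ⁺` true in the canonical model. Only `⬥` asks for witnesses in
  -- `G`: one for each ban `c` that a world with partition `S` may carry. For `■`, accessibility
  -- itself transports the boxed formulas.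
  Pos : List Part → Part → NNF Var → Set
  Pos G S (lit s p) = ¬ lit s p ∈ S ⁻
  Pos G S (A ⊓ B)   = A ∈ S ⁺ × B ∈ S ⁺
  Pos G S (A ⊔ B)   = A ∈ S ⁺ ⊎ B ∈ S ⁺
  Pos G S (A ⇒ B)   = A ∈ S ⁻ ⊎ B ∈ S ⁺
  Pos G S (■ i A)   = A ∈ Σ
  Pos G S (⬥ i A)   = ∀ {c} → c ∈ Σ →
    Realised G (λ D → ■ i D ∈ S ⁺ ⊎ D ≡ A) (Banned S c i)

  -- `⇒` and `■` ask for a refuting survivor. `⬥ i A` is refuted through a world with the same
  -- partition and the ban `⬥ i A`, so only membership of `A` in `Σ` is recorded.
  Neg : List Part → Part → NNF Var → Set
  Neg G S (lit s p) = ¬ lit s p ∈ S ⁺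
  Neg G S (A ⊓ B)   = A ∈ S ⁻ ⊎ B ∈ S ⁻
  Neg G S (A ⊔ B)   = A ∈ S ⁻ × B ∈ S ⁻
  Neg G S (A ⇒ B)   = Realised G (λ D → D ∈ S ⁺ ⊎ D ≡ A) (_≡ B)
  Neg G S (■ i A)   = Realised G (λ D → ■ i D ∈ S ⁺) (_≡ A)
  Neg G S (⬥ i A)   = A ∈ Σ

  Good : List Part → Part → Set
  Good G S = (∀ {A} → A ∈ S ⁺ → Pos G S A) × (∀ {A} → A ∈ S ⁻ → Neg G S A)

  -- The invariant of the elimination: a partition may be missing from the list only if its sequent
  -- is valid.
  record Covering (G : List Part) : Set (Level.suc ℓ) where
    field
      bound : ∀ {S} → S ∈ G → S ∈ partitions Σ
      cover : ∀ {S} → S ∈ partitions Σ → S ∈ G ⊎ Refuted S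

  module _ {G : List Part} (covering : Covering G) where
    open Covering covering

    -- If every survivor clashes with `Γ` and `Δ`, cuts over `Σ` prove the sequent from `Γ` to `Δ`:
    -- a discarded partition is closed by its refutation, a survivor by its clash.
    extend : ∀ {Γ Δ} → Decidable Γ → Decidable Δ → Realised G Γ Δ ⊎ Entails Γ Δ
    extend {Γ} {Δ} Γ? Δ? = Sum.map₂ entails (∀-⊎-distrib G realise)
      where
      fit : ∀ {T} → T ∈ G → ∀ {A} → A ∈ Σ →
            Clash Γ Δ T ⊎ ((Γ A → A ∈ T ⁺) × (Δ A → A ∈ T ⁻))
      fit T∈G {A} A∈Σ with partitions-complete Σ (bound T∈G) A∈Σ
      ... | inj₁ A∈T⁺ with Δ? A
      ...   | yes d = inj₁ (A , inj₂ (d , A∈T⁺))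
      ...   | no ¬d = inj₂ ((λ _ → A∈T⁺) , λ d → contradiction d ¬d)
      fit T∈G {A} A∈Σ | inj₂ A∈T⁻ with Γ? A
      ...   | yes g = inj₁ (A , inj₁ (g , A∈T⁻))
      ...   | no ¬g = inj₂ ((λ g → contradiction g ¬g) , λ _ → A∈T⁻)

      realise : ∀ {T} → T ∈ G → Realised G Γ Δ ⊎ Clash Γ Δ T
      realise {T} T∈G = [ inj₂ , (λ e → inj₁ (T , T∈G , e)) ]′ (∀-⊎-distrib Σ (fit T∈G))

      entails : (∀ {T} → T ∈ G → Clash Γ Δ T) → Entails Γ Δ
      entails clash K w hΓ = cut Σ step
        where
        open Forcing K
        step : ∀ {P N} → (P , N) ∈ partitions Σ → All (w ⊩_) P →
               Any (w ⊩_) N ⊎ (∃[ A ] (Δ A × w ⊩ A))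
        step m hP with cover m
        ... | inj₂ refuted =
          let A , A∈N , h = refuted K w (All.lookup hP) in inj₁ (lose A∈N h)
        ... | inj₁ T∈G with clash T∈G
        ...   | A , inj₁ (g , A∈N) = inj₁ (lose A∈N (hΓ g))
        ...   | A , inj₂ (d , A∈P) = inj₂ (A , d , All.lookup hP A∈P)

    module _ {S : Part} (S∈ : S ∈ partitions Σ) where

      side : ∀ {A} → A ∈ Σ → A ∈ S ⁺ ⊎ A ∈ S ⁻
      side = partitions-complete Σ S∈

      pos∈Σ : ∀ {A} → A ∈ S ⁺ → A ∈ Σ
      pos∈Σ = partitions-sound Σ S∈ ∘ inj₁

      neg∈Σ : ∀ {A} → A ∈ S ⁻ → A ∈ Σ
      neg∈Σ = partitions-sound Σ S∈ ∘ inj₂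

      Banned? : ∀ c i → Decidable (Banned S c i)
      Banned? c i A = (⬥ i A ≟ₙ c) ×-dec (c ∈? S ⁻)

      -- A failing condition makes the sequent of `S` valid. For `⊓`, `⊔` and `⇒` the sides of the
      -- immediate subformulas decide; for `⬥` a missing witness turns into an entailment by
      -- `extend`.
      check⁺ : ∀ A → A ∈ S ⁺ → Refuted S ⊎ Pos G S A
      check⁺ (lit s p) m with lit s p ∈? S ⁻
      ... | yes n = inj₁ λ K w h → _ , n , h m
      ... | no ¬n = inj₂ ¬n
      check⁺ (A ⊓ B) m
        with side (sub (pos∈Σ m) (there (left A B))) | side (sub (pos∈Σ m) (there (right A B)))
      ... | inj₁ a | inj₁ b = inj₂ (a , b)
      ... | inj₂ a | _      = inj₁ λ K w h → A , a , proj₁ (h m)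
      ... | inj₁ _ | inj₂ b = inj₁ λ K w h → B , b , proj₂ (h m)
      check⁺ (A ⊔ B) m
        with side (sub (pos∈Σ m) (there (left A B))) | side (sub (pos∈Σ m) (there (right A B)))
      ... | inj₁ a | _      = inj₂ (inj₁ a)
      ... | inj₂ _ | inj₁ b = inj₂ (inj₂ b)
      ... | inj₂ a | inj₂ b = inj₁ λ K w h → [ (λ x → A , a , x) , (λ x → B , b , x) ]′ (h m)
      check⁺ (A ⇒ B) m
        with side (sub (pos∈Σ m) (there (left A B))) | side (sub (pos∈Σ m) (there (right A B)))
      ... | inj₂ a | _      = inj₂ (inj₁ a)
      ... | inj₁ _ | inj₁ b = inj₂ (inj₂ b)
      ... | inj₁ a | inj₂ b = inj₁ λ K w h → B , b , h m w (Kripke.≤-refl K) (h a)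
      check⁺ (■ i A) m = inj₂ (sub (pos∈Σ m) (there (∈-subformulas-refl A)))
      check⁺ (⬥ i A) m = ∀-⊎-distrib Σ λ {c} _ →
        Sum.swap (Sum.map₂ (refute c)
          (extend (λ D → (■ i D ∈? S ⁺) ⊎-dec (D ≟ₙ A)) (Banned? c i)))
        where
        refute : ∀ c → Entails (λ D → ■ i D ∈ S ⁺ ⊎ D ≡ A) (Banned S c i) → Refuted S
        -- An `i`-successor of `w` forces some banned formula `D`, which reveals `c` as `⬥ i D` in
        -- `S ⁻`. Since the same happens at every `w′` above `w`, `⬥ i D` holds at `w`.
        refute c entails K w h = conclude (witness w ≤-refl)
          where
          open Kripke K
          open Forcing K
          Witness : W → Set ℓ
          Witness w′ = ∃[ w″ ] (R i w′ w″ × (∃[ D ] (Banned S c i D × w″ ⊩ D)))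
          witness : ∀ w′ → w ≤ w′ → Witness w′
          witness w′ le with h m w′ le
          ... | w″ , r , a = w″ , r , entails K w″ λ where
            (inj₁ n)    → h n w′ le w″ r
            (inj₂ refl) → a
          conclude : Witness w → ∃[ D ] (D ∈ S ⁻ × w ⊩ D)
          conclude (_ , _ , D , (refl , n) , _) = ⬥ i D , n , support
            where
            support : w ⊩ ⬥ i D
            support w′ le with witness w′ le
            ... | w″ , r , _ , (refl , _) , d = w″ , r , d

      -- For `⇒` and `■`, the entailment that `extend` returns in place of a witness makes the
      -- formula true wherever all of `S ⁺` is; for `⇒` this also uses persistence.
      check⁻ : ∀ A → A ∈ S ⁻ → Refuted S ⊎ Neg G S A
      check⁻ (lit s p) m with lit s p ∈? S ⁺
      ... | yes n = inj₁ λ K w h → _ , m , h n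
      ... | no ¬n = inj₂ ¬n
      check⁻ (A ⊓ B) m
        with side (sub (neg∈Σ m) (there (left A B))) | side (sub (neg∈Σ m) (there (right A B)))
      ... | inj₂ a | _      = inj₂ (inj₁ a)
      ... | inj₁ _ | inj₂ b = inj₂ (inj₂ b)
      ... | inj₁ a | inj₁ b = inj₁ λ K w h → A ⊓ B , m , h a , h b
      check⁻ (A ⊔ B) m
        with side (sub (neg∈Σ m) (there (left A B))) | side (sub (neg∈Σ m) (there (right A B)))
      ... | inj₂ a | inj₂ b = inj₂ (a , b)
      ... | inj₁ a | _      = inj₁ λ K w h → A ⊔ B , m , inj₁ (h a)
      ... | inj₂ _ | inj₁ b = inj₁ λ K w h → A ⊔ B , m , inj₂ (h b)
      check⁻ (A ⇒ B) m =
        Sum.swap (Sum.map₂ refute (extend (λ D → (D ∈? S ⁺) ⊎-dec (D ≟ₙ A)) (_≟ₙ B)))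
        where
        refute : Entails (λ D → D ∈ S ⁺ ⊎ D ≡ A) (_≡ B) → Refuted S
        refute entails K w h = A ⇒ B , m , imp
          where
          open Kripke K
          open Forcing K
          imp : w ⊩ A ⇒ B
          imp w′ le a
            with entails K w′ (λ { {D} (inj₁ n) → ⊩-upward D le (h n) ; (inj₂ refl) → a })
          ... | _ , refl , b = b
      check⁻ (■ i A) m =
        Sum.swap (Sum.map₂ refute (extend (λ D → ■ i D ∈? S ⁺) (_≟ₙ A)))
        where
        refute : Entails (λ D → ■ i D ∈ S ⁺) (_≡ A) → Refuted S
        refute entails K w h = ■ i A , m , λ w′ le w″ r →
          let _ , eq , a = entails K w″ λ n → h n w′ le w″ r
          in subst (Forcing._⊩_ K w″) eq a
      check⁻ (⬥ i A) m = inj₂ (sub (neg∈Σ m) (there (∈-subformulas-refl A)))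

      check : Refuted S ⊎ Good G S
      check with ∀-⊎-distrib (S ⁺) (check⁺ _) | ∀-⊎-distrib (S ⁻) (check⁻ _)
      ... | inj₁ r | _      = inj₁ r
      ... | inj₂ _ | inj₁ r = inj₁ r
      ... | inj₂ p | inj₂ n = inj₂ (p , n)

    remove : ∀ {S} xs {ys} → G ≡ xs ++ S ∷ ys → Refuted S → Covering (xs ++ ys)
    remove xs refl refuted .Covering.bound T∈ with ∈-++⁻ xs T∈
    ... | inj₁ m = bound (∈-++⁺ˡ m)
    ... | inj₂ m = bound (∈-++⁺ʳ xs (there m))
    remove xs refl refuted .Covering.cover T∈ with cover T∈
    ... | inj₂ r = inj₂ r
    ... | inj₁ T∈G with ∈-++⁻ xs T∈G
    ...   | inj₁ m           = inj₁ (∈-++⁺ˡ m)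
    ...   | inj₂ (here refl) = inj₂ refuted
    ...   | inj₂ (there m)   = inj₁ (∈-++⁺ʳ xs m)

  -- `Good` depends on the current list, so all survivors are examined again after each removal; `n`
  -- bounds the length and decreases with every removal.
  saturate : ∀ n G → length G ℕ.≤ n → Covering G →
             ∃[ G′ ] (Covering G′ × (∀ {S} → S ∈ G′ → Good G′ S))
  saturate n G len covering
    with ∀-⊎-distrib {R = ∃[ S ] (S ∈ G × Refuted S)} G
           (λ {S} S∈G → Sum.map₁ (λ r → S , S∈G , r)
             (check covering (Covering.bound covering S∈G)))
  ... | inj₂ good = G , covering , good
  ... | inj₁ (S , S∈G , refuted) with ∈-∃++ S∈G
  saturate zero G len covering | inj₁ (S , S∈G , refuted) | xs , ys , refl
    with () ← subst (ℕ._≤ 0) (length-++-sucʳ xs S ys) len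
  saturate (suc n) G len covering | inj₁ (S , S∈G , refuted) | xs , ys , refl =
    saturate n (xs ++ ys)
      (ℕ.s≤s⁻¹ (subst (ℕ._≤ suc n) (length-++-sucʳ xs S ys) len))
      (remove covering xs refl refuted)

  saturated : ∃[ G ] (Covering G × (∀ {S} → S ∈ G → Good G S))
  saturated = saturate _ (partitions Σ) ℕ.≤-refl record { bound = id ; cover = inj₁ }

  -- The canonical model

  module Canonical {G : List Part} (covering : Covering G)
                   (good : ∀ {S} → S ∈ G → Good G S) where
    open Covering covering

    -- Refuting `⬥ i A` takes one world above, all of whose successors refute `A`; different
    -- diamonds may need different such worlds. Hence each survivor is copied once for every ban in
    -- `Σ`, which can name the diamond to be refuted.
    record World : Set where
      constructor world
      field
        part    : Part
        part∈G  : part ∈ G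
        ban     : NNF Var
        ban∈Σ   : ban ∈ Σ

    open World

    -- Bans are ignored, so all copies of one partition lie below each other; `nothing` is the added
    -- root.
    data _≼_ : Rel (Maybe World) 0ℓ where
      root≼ : ∀ {y} → nothing ≼ y
      part≼ : ∀ {x y} → (∀ {A} → A ∈ part x ⁺ → A ∈ part y ⁺) → just x ≼ just y

    ≼-refl : ∀ {x} → x ≼ x
    ≼-refl {just _}  = part≼ id
    ≼-refl {nothing} = root≼

    ≼-trans : ∀ {x y z} → x ≼ y → y ≼ z → x ≼ z
    ≼-trans root≼     _         = root≼
    ≼-trans (part≼ f) (part≼ g) = part≼ (g ∘ f)

    -- A successor puts the formulas boxed at `x` on its positive side and the formula banned at
    -- `x`, if any, on its negative side.
    data Access (i : Fin 4) : Rel (Maybe World) 0ℓ where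
      access : ∀ {x y} → Extends (λ A → ■ i A ∈ part x ⁺) (Banned (part x) (ban x) i) (part y) →
               Access i (just x) (just y)

    data Holds (s : Sign) (p : Var) : Pred (Maybe World) 0ℓ where
      holds : ∀ {x} → lit s p ∈ part x ⁺ → Holds s p (just x)

    Holds-upward : ∀ {s p x y} → x ≼ y → Holds s p x → Holds s p y
    Holds-upward (part≼ f) (holds m) = holds (f m)

    -- Built at level zero and lifted, so that `Valid ℓ` can be applied to it for any `ℓ`.
    K : Kripke Var ℓ
    K = record
      { W          = Lift ℓ (Maybe World)
      ; _≤_        = λ x y → Lift ℓ (lower x ≼ lower y)
      ; isPreorder = record
        { isEquivalence = isEquivalence
        ; reflexive     = λ { refl → lift ≼-refl }
        ; trans         = λ p q → lift (≼-trans (lower p) (lower q))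
        }
      ; R          = λ i x y → Lift ℓ (Access i (lower x) (lower y))
      ; v⁺         = λ p x → Lift ℓ (Holds Sign.+ p (lower x))
      ; v⁻         = λ p x → Lift ℓ (Holds Sign.- p (lower x))
      ; v⁺-upward  = λ p le h → lift (Holds-upward (lower le) (lower h))
      ; v⁻-upward  = λ p le h → lift (Holds-upward (lower le) (lower h))
      }

    open Forcing K

    root : Lift ℓ (Maybe World)
    root = lift nothing

    root-least : ∀ x → Kripke._≤_ K root x
    root-least x = lift root≼

    ⟨_⟩ : World → Lift ℓ (Maybe World)
    ⟨ x ⟩ = lift (just x)

    -- Simultaneous induction on the formula: the implication cases call the other sign on the
    -- antecedent. The world varies in the induction, since the negative modal cases pass to copies
    -- with another ban.
    truth⁺ : ∀ A x → A ∈ part x ⁺ → ⟨ x ⟩ ⊩ A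
    truth⁻ : ∀ A x → A ∈ part x ⁻ → ¬ ⟨ x ⟩ ⊩ A

    truth⁺ (lit Sign.+ p) x m = lift (holds m)
    truth⁺ (lit Sign.- p) x m = lift (holds m)
    truth⁺ (A ⊓ B) x m =
      let a , b = proj₁ (good (part∈G x)) m in truth⁺ A x a , truth⁺ B x b
    truth⁺ (A ⊔ B) x m = Sum.map (truth⁺ A x) (truth⁺ B x) (proj₁ (good (part∈G x)) m)
    truth⁺ (A ⇒ B) x m (lift (just y)) (lift (part≼ f)) h
      with proj₁ (good (part∈G y)) (f m)
    ... | inj₁ a = contradiction h (truth⁻ A y a)
    ... | inj₂ b = truth⁺ B y b
    truth⁺ (■ i A) x m (lift (just y)) (lift (part≼ f)) (lift (just z)) (lift (access e)) =
      -- `Pos` at `■ i A` supplies `A ∈ Σ`; the box moves up to `y` along `f`, and accessibility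
      -- then places `A` on the positive side of `z`.
      truth⁺ A z (proj₁ (e (proj₁ (good (part∈G x)) m)) (f m))
    truth⁺ (⬥ i A) x m (lift (just y)) (lift (part≼ f))
      -- Of the witnesses for all bans, the one for the ban of `y` is accessible from `y`. Any ban
      -- would do for the new world; that of `y` is reused.
      with proj₁ (good (part∈G y)) (f m) (ban∈Σ y)
    ... | T , T∈G , e =
      let z = world T T∈G (ban y) (ban∈Σ y)
          ⬥A∈Σ = partitions-sound Σ (bound (part∈G x)) (inj₁ m)
          A∈Σ = sub ⬥A∈Σ (there (∈-subformulas-refl A))
      in ⟨ z ⟩ , lift (access λ D∈Σ → proj₁ (e D∈Σ) ∘ inj₁ , proj₂ (e D∈Σ))
           , truth⁺ A z (proj₁ (e A∈Σ) (inj₂ refl))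

    truth⁻ (lit Sign.+ p) x m (lift (holds n)) = proj₂ (good (part∈G x)) m n
    truth⁻ (lit Sign.- p) x m (lift (holds n)) = proj₂ (good (part∈G x)) m n
    truth⁻ (A ⊓ B) x m (a , b) =
      [ (λ n → truth⁻ A x n a) , (λ n → truth⁻ B x n b) ]′ (proj₂ (good (part∈G x)) m)
    truth⁻ (A ⊔ B) x m =
      let a , b = proj₂ (good (part∈G x)) m in [ truth⁻ A x a , truth⁻ B x b ]′
    truth⁻ (A ⇒ B) x m h with proj₂ (good (part∈G x)) m
    ... | T , T∈G , e =
      let y = world T T∈G (ban x) (ban∈Σ x)
          A⇒B∈Σ = partitions-sound Σ (bound (part∈G x)) (inj₂ m)
          a = proj₁ (e (sub A⇒B∈Σ (there (left A B)))) (inj₂ refl)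
          b = proj₂ (e (sub A⇒B∈Σ (there (right A B)))) refl
          x≤y : ∀ {D} → D ∈ part x ⁺ → D ∈ T ⁺
          x≤y n = proj₁ (e (partitions-sound Σ (bound (part∈G x)) (inj₁ n))) (inj₁ n)
      in truth⁻ B y b (h ⟨ y ⟩ (lift (part≼ x≤y)) (truth⁺ A y a))
    -- A ban that is not of the form ⬥ i D is void: here it is ■ i A itself.
    truth⁻ (■ i A) x m h with proj₂ (good (part∈G x)) m
    ... | T , T∈G , e =
      let ■A∈Σ = partitions-sound Σ (bound (part∈G x)) (inj₂ m)
          A∈Σ = sub ■A∈Σ (there (∈-subformulas-refl A))
          y = world (part x) (part∈G x) (■ i A) ■A∈Σ
          z = world T T∈G (■ i A) ■A∈Σ
      in truth⁻ A z (proj₂ (e A∈Σ) refl)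
           (h ⟨ y ⟩ (lift (part≼ id)) ⟨ z ⟩
             (lift (access λ D∈Σ → proj₁ (e D∈Σ) , λ ())))
    truth⁻ (⬥ i A) x m h
      -- The copy of `x` with ban `⬥ i A` lies above `x`, and all its `i`-successors have `A` on
      -- their negative side.
      with h ⟨ world (part x) (part∈G x) (⬥ i A) (partitions-sound Σ (bound (part∈G x)) (inj₂ m)) ⟩
             (lift (part≼ id))
    ... | lift (just z) , lift (access e) , a =
      truth⁻ A z (proj₂ (e (proj₂ (good (part∈G x)) m)) (refl , m)) a

-- The disjunction property for normal forms

disjunction-property : ∀ {Var : Set} → DecidableEquality Var → (ℓ : Level) (A B : NNF Var) →
                       Valid ℓ (A ⊔ B) → Valid ℓ A ⊎ Valid ℓ B
disjunction-property {Var} _≟ᵥ_ ℓ A B valid with Elimination.saturated _≟ᵥ_ ℓ (A ⊔ B)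
... | G , covering , good = conclude (decide A (there (left A B))) (decide B (there (right A B)))
  where
  open Elimination _≟ᵥ_ ℓ (A ⊔ B)
  open Canonical covering good
  open Forcing K

  decide : ∀ D → D ∈ Σ → (¬ root ⊩ D) ⊎ Valid ℓ D
  -- The sequent without premises and with conclusion `D`: a survivor realising it refutes `D`,
  -- hence so does the root by persistence; otherwise `D` is valid.
  decide D D∈Σ with extend covering {Γ = λ _ → ⊥} {Δ = _≡ D} (λ _ → no λ ()) (_≟ₙ D)
  ... | inj₁ (T , T∈G , e) =
    let x = world T T∈G D D∈Σ
    in inj₁ λ h → truth⁻ D x (proj₂ (e D∈Σ) refl) (⊩-upward D (root-least ⟨ x ⟩) h)
  ... | inj₂ entails = inj₂ λ K w →
    let _ , eq , h = entails K w λ () in subst (Forcing._⊩_ K w) eq h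

  conclude : (¬ root ⊩ A) ⊎ Valid ℓ A → (¬ root ⊩ B) ⊎ Valid ℓ B → Valid ℓ A ⊎ Valid ℓ B
  conclude (inj₂ a)  _         = inj₁ a
  conclude (inj₁ _)  (inj₂ b)  = inj₂ b
  conclude (inj₁ ¬a) (inj₁ ¬b) = ⊥-elim ([ ¬a , ¬b ]′ (valid K root))

-- Translation of the logics

-- One representative from each group of relations that the frames of the logic identify; in `nnf`,
-- equality of relations thus becomes equality of indices.
rep : Logic → Fin 4 → Fin 4
rep CN4K  i  = i
rep CN4K± □⁺ = □⁺
rep CN4K± □⁻ = □⁻
rep CN4K± ◇⁺ = □⁺
rep CN4K± ◇⁻ = □⁻
rep CN4K⋎ □⁺ = □⁺
rep CN4K⋎ □⁻ = □⁺
rep CN4K⋎ ◇⁺ = ◇⁺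
rep CN4K⋎ ◇⁻ = ◇⁺
rep CN4K⋈ □⁺ = □⁺
rep CN4K⋈ □⁻ = ◇⁺
rep CN4K⋈ ◇⁺ = ◇⁺
rep CN4K⋈ ◇⁻ = □⁺
rep CN4K¹ _  = □⁺

relation : ∀ {ℓ} (F : Frame ℓ) → Fin 4 → Rel (Frame.W F) ℓ
relation F □⁺ = Frame.R□⁺ F
relation F □⁻ = Frame.R□⁻ F
relation F ◇⁺ = Frame.R◇⁺ F
relation F ◇⁻ = Frame.R◇⁻ F

relation-rep : ∀ {ℓ} L {F : Frame ℓ} → FrameOf L F →
               ∀ i → relation F (rep L i) ⇔ᵣ relation F i
relation-rep CN4K  _                     i  = id , id
relation-rep CN4K± _                     □⁺ = id , id
relation-rep CN4K± _                     □⁻ = id , id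
relation-rep CN4K± (e , _)               ◇⁺ = e
relation-rep CN4K± (_ , e)               ◇⁻ = e
relation-rep CN4K⋎ _                     □⁺ = id , id
relation-rep CN4K⋎ (e , _)               □⁻ = e
relation-rep CN4K⋎ _                     ◇⁺ = id , id
relation-rep CN4K⋎ (_ , e)               ◇⁻ = e
relation-rep CN4K⋈ _                     □⁺ = id , id
relation-rep CN4K⋈ (_ , e)               □⁻ = e
relation-rep CN4K⋈ _                     ◇⁺ = id , id
relation-rep CN4K⋈ (e , _)               ◇⁻ = e
relation-rep CN4K¹ _                     □⁺ = id , id
relation-rep CN4K¹ (e , _)               □⁻ = e
relation-rep CN4K¹ ((a , b) , (c , d) , _) ◇⁺ = c ∘ a , b ∘ d
relation-rep CN4K¹ ((a , b) , (c , d) , (e , f)) ◇⁻ = e ∘ c ∘ a , b ∘ d ∘ f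

module _ {Var : Set} (L : Logic) where

  nnf : Sign → Formula Var → NNF Var
  nnf s      (var p) = lit s p
  nnf s      (∼ φ)   = nnf (opposite s) φ
  nnf Sign.+ (φ ∧ χ) = nnf Sign.+ φ ⊓ nnf Sign.+ χ
  nnf Sign.- (φ ∧ χ) = nnf Sign.- φ ⊔ nnf Sign.- χ
  nnf Sign.+ (φ ∨ χ) = nnf Sign.+ φ ⊔ nnf Sign.+ χ
  nnf Sign.- (φ ∨ χ) = nnf Sign.- φ ⊓ nnf Sign.- χ
  nnf Sign.+ (φ ⊃ χ) = nnf Sign.+ φ ⇒ nnf Sign.+ χ
  nnf Sign.- (φ ⊃ χ) = nnf Sign.+ φ ⊓ nnf Sign.- χ
  nnf Sign.+ (□ φ)   = ■ (rep L □⁺) (nnf Sign.+ φ)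
  nnf Sign.- (□ φ)   = ⬥ (rep L □⁻) (nnf Sign.- φ)
  nnf Sign.+ (◇ φ)   = ⬥ (rep L ◇⁺) (nnf Sign.+ φ)
  nnf Sign.- (◇ φ)   = ■ (rep L ◇⁻) (nnf Sign.- φ)

  module _ {ℓ : Level} where

    kripke : {F : Frame ℓ} → Model Var F → (Fin 4 → Rel (Frame.W F) ℓ) → Kripke Var ℓ
    kripke {F} M R = record
      { W          = Frame.W F
      ; _≤_        = Frame._≤_ F
      ; isPreorder = Frame.isPreorder F
      ; R          = R
      ; v⁺         = Model.v⁺ M
      ; v⁻         = Model.v⁻ M
      ; v⁺-upward  = Model.v⁺-upward M
      ; v⁻-upward  = Model.v⁻-upward M
      }

    module _ {F : Frame ℓ} (M : Model Var F) (R : Fin 4 → Rel (Frame.W F) ℓ)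
             (R-rep : ∀ i → R (rep L i) ⇔ᵣ relation F i) where
      open Support M
      open Forcing (kripke M R)

      infix 4 _⊩[_]_

      _⊩[_]_ : Frame.W F → Sign → Formula Var → Set ℓ
      w ⊩[ Sign.+ ] φ = w ⊩⁺ φ
      w ⊩[ Sign.- ] φ = w ⊩⁻ φ

      -- The two directions are mutual because `⊃` is contravariant on the left. The family `R` is
      -- left open to cover two uses: the relations of a given frame, and those of an arbitrary
      -- Kripke structure.
      toNNF   : ∀ s φ {w} → w ⊩[ s ] φ → w ⊩ nnf s φ
      fromNNF : ∀ s φ {w} → w ⊩ nnf s φ → w ⊩[ s ] φ

      toNNF Sign.+ (var p) h       = h
      toNNF Sign.- (var p) h       = h
      toNNF Sign.+ (∼ φ)   h       = toNNF Sign.- φ h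
      toNNF Sign.- (∼ φ)   h       = toNNF Sign.+ φ h
      toNNF Sign.+ (φ ∧ χ) (h , k) = toNNF Sign.+ φ h , toNNF Sign.+ χ k
      toNNF Sign.- (φ ∧ χ) h       = Sum.map (toNNF Sign.- φ) (toNNF Sign.- χ) h
      toNNF Sign.+ (φ ∨ χ) h       = Sum.map (toNNF Sign.+ φ) (toNNF Sign.+ χ) h
      toNNF Sign.- (φ ∨ χ) (h , k) = toNNF Sign.- φ h , toNNF Sign.- χ k
      toNNF Sign.+ (φ ⊃ χ) h       = λ u le k → toNNF Sign.+ χ (h u le (fromNNF Sign.+ φ k))
      toNNF Sign.- (φ ⊃ χ) (h , k) = toNNF Sign.+ φ h , toNNF Sign.- χ k
      toNNF Sign.+ (□ φ)   h       = λ u le v r → toNNF Sign.+ φ (h u le v (proj₁ (R-rep □⁺) r))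
      toNNF Sign.- (□ φ)   h       = λ u le →
        let v , r , k = h u le in v , proj₂ (R-rep □⁻) r , toNNF Sign.- φ k
      toNNF Sign.+ (◇ φ)   h       = λ u le →
        let v , r , k = h u le in v , proj₂ (R-rep ◇⁺) r , toNNF Sign.+ φ k
      toNNF Sign.- (◇ φ)   h       = λ u le v r → toNNF Sign.- φ (h u le v (proj₁ (R-rep ◇⁻) r))

      fromNNF Sign.+ (var p) h       = h
      fromNNF Sign.- (var p) h       = h
      fromNNF Sign.+ (∼ φ)   h       = fromNNF Sign.- φ h
      fromNNF Sign.- (∼ φ)   h       = fromNNF Sign.+ φ h
      fromNNF Sign.+ (φ ∧ χ) (h , k) = fromNNF Sign.+ φ h , fromNNF Sign.+ χ k
      fromNNF Sign.- (φ ∧ χ) h       = Sum.map (fromNNF Sign.- φ) (fromNNF Sign.- χ) h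
      fromNNF Sign.+ (φ ∨ χ) h       = Sum.map (fromNNF Sign.+ φ) (fromNNF Sign.+ χ) h
      fromNNF Sign.- (φ ∨ χ) (h , k) = fromNNF Sign.- φ h , fromNNF Sign.- χ k
      fromNNF Sign.+ (φ ⊃ χ) h       = λ u le k → fromNNF Sign.+ χ (h u le (toNNF Sign.+ φ k))
      fromNNF Sign.- (φ ⊃ χ) (h , k) = fromNNF Sign.+ φ h , fromNNF Sign.- χ k
      fromNNF Sign.+ (□ φ)   h       = λ u le v r → fromNNF Sign.+ φ (h u le v (proj₂ (R-rep □⁺) r))
      fromNNF Sign.- (□ φ)   h       = λ u le →
        let v , r , k = h u le in v , proj₁ (R-rep □⁻) r , fromNNF Sign.- φ k
      fromNNF Sign.+ (◇ φ)   h       = λ u le →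
        let v , r , k = h u le in v , proj₁ (R-rep ◇⁺) r , fromNNF Sign.+ φ k
      fromNNF Sign.- (◇ φ)   h       = λ u le v r → fromNNF Sign.- φ (h u le v (proj₂ (R-rep ◇⁻) r))

    module _ (K : Kripke Var ℓ) (w : Kripke.W K) where
      open Kripke K

      -- Relations are read off at representatives, so those that `L` identifies coincide
      -- definitionally and the frame lies in its class.
      frame : Frame ℓ
      frame = record
        { W          = W
        -- The world under evaluation doubles as the witness of nonemptiness.
        ; nonempty   = w
        ; _≤_        = _≤_
        ; isPreorder = isPreorder
        ; R□⁺        = R (rep L □⁺)
        ; R□⁻        = R (rep L □⁻)
        ; R◇⁺        = R (rep L ◇⁺)
        ; R◇⁻        = R (rep L ◇⁻)
        }

      model : Model Var frame
      model = record
        { v⁺ = v⁺ ; v⁻ = v⁻ ; v⁺-upward = v⁺-upward ; v⁻-upward = v⁻-upward }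

      relation-frame : ∀ i → R (rep L i) ⇔ᵣ relation frame i
      relation-frame □⁺ = id , id
      relation-frame □⁻ = id , id
      relation-frame ◇⁺ = id , id
      relation-frame ◇⁻ = id , id

frame-FrameOf : ∀ {Var ℓ} L (K : Kripke Var ℓ) w → FrameOf L (frame L K w)
frame-FrameOf CN4K  K w = _
frame-FrameOf CN4K± K w = (id , id) , (id , id)
frame-FrameOf CN4K⋎ K w = (id , id) , (id , id)
frame-FrameOf CN4K⋈ K w = (id , id) , (id , id)
frame-FrameOf CN4K¹ K w = (id , id) , (id , id) , (id , id)

-- Transfer of validity between the logics and normal forms

module _ {Var : Set} {ℓ : Level} (L : Logic) where

  ⊨⇒Valid : (φ : Formula Var) → L ⊨[ ℓ ] φ → Valid ℓ (nnf L Sign.+ φ)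
  ⊨⇒Valid φ valid K w =
    toNNF L (model L K w) (Kripke.R K) (relation-frame L K w) Sign.+ φ
      (valid (frame L K w) (frame-FrameOf L K w) (model L K w) w)

  Valid⇒⊨ : (φ : Formula Var) → Valid ℓ (nnf L Sign.+ φ) → L ⊨[ ℓ ] φ
  Valid⇒⊨ φ valid F F∈L M w =
    fromNNF L M (relation F) (relation-rep L F∈L) Sign.+ φ (valid (kripke L M (relation F)) w)

theorem8 : (Var : Set) → (Var ↣ ℕ) → (ℓ : Level) (L : Logic) (φ χ : Formula Var) →
    ((L ⊨[ ℓ ] (φ ∨ χ)) ⇔ ((L ⊨[ ℓ ] φ) ⊎ (L ⊨[ ℓ ] χ)))
    × ((L ⊨[ ℓ ] (∼ (φ ∧ χ))) ⇔ ((L ⊨[ ℓ ] (∼ φ)) ⊎ (L ⊨[ ℓ ] (∼ χ))))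
theorem8 Var inj ℓ L φ χ = disjunction φ χ , falsity
  where
  disjunction : ∀ φ χ → (L ⊨[ ℓ ] (φ ∨ χ)) ⇔ ((L ⊨[ ℓ ] φ) ⊎ (L ⊨[ ℓ ] χ))
  disjunction φ χ = mk⇔
    (λ valid → Sum.map (Valid⇒⊨ L φ) (Valid⇒⊨ L χ)
      -- Countability gives decidable equality of variables, hence of normal forms, on which the
      -- elimination rests.
      (disjunction-property (via-injection inj ℕ._≟_) ℓ (nnf L Sign.+ φ) (nnf L Sign.+ χ)
        (⊨⇒Valid L (φ ∨ χ) valid)))
    [ (λ valid F F∈L M w → inj₁ (valid F F∈L M w))
    , (λ valid F F∈L M w → inj₂ (valid F F∈L M w)) ]′

  -- ∼ (φ ∧ χ) and ∼ φ ∨ ∼ χ have definitionally equal positive support.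
  falsity : (L ⊨[ ℓ ] (∼ (φ ∧ χ))) ⇔ ((L ⊨[ ℓ ] (∼ φ)) ⊎ (L ⊨[ ℓ ] (∼ χ)))
  falsity = disjunction (∼ φ) (∼ χ)
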